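{- \textsc{Maximum Colored Cut} parameterized by the number $p$ of colors admits a kernel of size $O(p^3)$: there is a polynomial-time algorithm that, given an instance $(G,c,k)$ with $c:E(G)\to\{1,\ldots,p\}$, outputs an equivalent instance $(G',c',k')$ with $c':E(G')\to\{1,\ldots,p'\}$, $p'\le p$, $k'\le k$, and $|E(G')|=O(p^3)$ (indeed each color class of $c'$ has at most $2\binom{p}{2}$ edges).
   Context: An edge-colored graph is a simple graph $G=(V,E)$ together with a (not necessarily proper) map $c:E\to\{1,2,\ldots,p\}$. For a proper subset $S\subset V$, the edge cut $\partial S$ is the set of edges with one endpoint in $S$ and the other in $V\setminus S$, and $c(\partial S)=\{c(e): e\in\partial S\}$. \textsc{Maximum Colored Cut}: given a graph $G=(V,E)$, an edge coloring $c:E\to\{1,\ldots,p\}$ and an integer $k>0$, decide whether there is a proper subset $S\subset V$ with $|c(\partial S)|\ge k$. Two instances are equivalent if both are yes-instances or both are no-instances.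
   Formalization: The bound on each color class is max(1, 2·C(p,2)), since for p = 1 the stated bound 0 fails (one edge, p = k = 1); for p ≥ 2 it is unchanged. As in the clause after the colon, kernel size is measured by the number of edges only. -}

module Defs where

open import Data.Fin.Base using (Fin; toℕ; _<_)
import Data.Fin.Properties as Fin
open import Data.Fin.Subset using (Subset; _∈_; _∉_; _⊂_; ⊤; ⁅_⁆; ⋃; ∣_∣)
open import Data.Fin.Subset.Properties using (_∈?_)
open import Data.List.Base using (List; []; _∷_; map; filter; foldr; length; allFin)
open import Data.List.Relation.Unary.All using (All)
open import Data.List.Relation.Unary.Unique.Propositional using (Unique)
open import Data.Nat.Base using (ℕ; zero; suc; _+_; _∸_; _*_; _^_; _≤_)
open import Data.Nat.Logarithm using (⌊log₂_⌋)
open import Data.Product.Base using (_×_; _,_; proj₁; proj₂; ∃-syntax; Σ-syntax)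
open import Data.Sum.Base using (_⊎_)
open import Data.Vec.Base using (Vec; _∷_; lookup; replicate; head; _[_]≔_)
open import Relation.Binary.PropositionalEquality.Core using (_≡_; _≢_)
open import Relation.Nullary.Decidable using (Dec; _×-dec_; _⊎-dec_; ¬?)
open import Relation.Nullary.Negation.Core using (¬_)

-- An edge {u , v} is stored as the pair (u , v) with u < v.
Edge : ℕ → Set
Edge n = Fin n × Fin n

-- V = Fin n.  The list `edges` is the graph of the colouring c : E → Fin p;
-- E itself is `map proj₁ edges`, and `simple` excludes parallel edges.
record EdgeColouredGraph (p : ℕ) : Set where
  field
    n       : ℕ
    edges   : List (Edge n × Fin p)
    ordered : All (λ e → proj₁ (proj₁ e) < proj₂ (proj₁ e)) edges
    simple  : Unique (map proj₁ edges)

  #edges : ℕ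
  #edges = length edges

  classSize : Fin p → ℕ
  classSize i = length (filter (λ e → proj₂ e Fin.≟ i) edges)

  Crosses : Subset n → Edge n × Fin p → Set
  Crosses S ((u , v) , _) = (u ∈ S × v ∉ S) ⊎ (u ∉ S × v ∈ S)

  crosses? : ∀ S e → Dec (Crosses S e)
  crosses? S ((u , v) , _) =
    ((u ∈? S) ×-dec ¬? (v ∈? S)) ⊎-dec (¬? (u ∈? S) ×-dec (v ∈? S))

  ∂ : Subset n → List (Edge n × Fin p)
  ∂ S = filter (crosses? S) edges

  c[∂_] : Subset n → Subset p
  c[∂ S ] = ⋃ (map (λ e → ⁅ proj₂ e ⁆) (∂ S))

record Instance : Set where
  field
    p     : ℕ
    graph : EdgeColouredGraph p
    k     : ℕ
    k>0   : 1 ≤ k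

  open EdgeColouredGraph graph public

  Yes : Set
  Yes = ∃[ S ] S ⊂ ⊤ × k ≤ ∣ c[∂ S ] ∣

Equivalent : Instance → Instance → Set
Equivalent I J =
  (Instance.Yes I × Instance.Yes J) ⊎ (¬ Instance.Yes I × ¬ Instance.Yes J)

-- Polynomial time is measured on WHILE programs over binary trees whose leaves are
-- natural numbers, with logarithmic cost; this is polynomially equivalent to
-- Turing machine time.

data Val : Set where
  nat  : ℕ → Val
  pair : Val → Val → Val

-- Up to a constant factor, the number of bits needed to write a value down.
‖_‖ : Val → ℕ
‖ nat n ‖    = suc ⌊log₂ n ⌋
‖ pair v w ‖ = suc (‖ v ‖ + ‖ w ‖)

data Op : Set where
  add monus mul : Op

⟦_⟧ : Op → ℕ → ℕ → ℕ
⟦ add   ⟧ = _+_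
⟦ monus ⟧ = _∸_
⟦ mul   ⟧ = _*_

data Expr (m : ℕ) : Set where
  var   : Fin m → Expr m
  lit   : ℕ → Expr m
  cons  : Expr m → Expr m → Expr m
  hd tl : Expr m → Expr m
  arith : Op → Expr m → Expr m → Expr m

Store : ℕ → Set
Store m = Vec Val m

-- Expressions are total: a leaf has components nat 0, and a pair counts as 0
-- in arithmetic.
first second : Val → Val
first  (nat _)    = nat 0
first  (pair v _) = v
second (nat _)    = nat 0
second (pair _ w) = w

asℕ : Val → ℕ
asℕ (nat n)    = n
asℕ (pair _ _) = 0

eval : ∀ {m} → Store m → Expr m → Val
eval σ (var x)       = lookup σ x
eval σ (lit n)       = nat n
eval σ (cons e f)    = pair (eval σ e) (eval σ f)
eval σ (hd e)        = first (eval σ e)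
eval σ (tl e)        = second (eval σ e)
eval σ (arith o e f) = nat (⟦ o ⟧ (asℕ (eval σ e)) (asℕ (eval σ f)))

-- Every intermediate value is charged its full size, so that a program cannot
-- cheaply build large trees by sharing or large numbers by multiplication.
cost : ∀ {m} → Store m → Expr m → ℕ
subcost : ∀ {m} → Store m → Expr m → ℕ
cost σ e = ‖ eval σ e ‖ + subcost σ e
subcost σ (var x)       = 0
subcost σ (lit n)       = 0
subcost σ (cons e f)    = cost σ e + cost σ f
subcost σ (hd e)        = cost σ e
subcost σ (tl e)        = cost σ e
subcost σ (arith _ e f) = cost σ e + cost σ f

data Cmd (m : ℕ) : Set where
  skip  : Cmd m
  _:=_  : Fin m → Expr m → Cmd m
  _⨾_   : Cmd m → Cmd m → Cmd m
  if    : Expr m → Cmd m → Cmd m → Cmd m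
  while : Expr m → Cmd m → Cmd m

infix  6 _:=_
infixr 5 _⨾_

-- In tests, nat 0 is false and every other value is true.
False : Val → Set
False v = v ≡ nat 0

True : Val → Set
True v = v ≢ nat 0

-- Exec C σ τ t: started in store σ, C halts in store τ after time t.
data Exec {m : ℕ} : Cmd m → Store m → Store m → ℕ → Set where
  skip    : ∀ {σ} → Exec skip σ σ 1
  assign  : ∀ {σ x e} → Exec (x := e) σ (σ [ x ]≔ eval σ e) (cost σ e)
  seq     : ∀ {C D σ τ υ s t} → Exec C σ τ s → Exec D τ υ t →
            Exec (C ⨾ D) σ υ (s + t)
  ifTrue  : ∀ {e C D σ τ t} → True (eval σ e) → Exec C σ τ t →
            Exec (if e C D) σ τ (cost σ e + t)
  ifFalse : ∀ {e C D σ τ t} → False (eval σ e) → Exec D σ τ t →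
            Exec (if e C D) σ τ (cost σ e + t)
  loop    : ∀ {e C σ τ υ s t} → True (eval σ e) → Exec C σ τ s →
            Exec (while e C) τ υ t → Exec (while e C) σ υ (cost σ e + (s + t))
  exit    : ∀ {e C σ} → False (eval σ e) → Exec (while e C) σ σ (cost σ e)

-- Input and output are passed in variable 0; all other variables start at nat 0.
Run : ∀ {m} → Cmd (suc m) → Val → Val → ℕ → Set
Run {m} P v w t = ∃[ τ ] Exec P (v ∷ replicate m (nat 0)) τ t × head τ ≡ w

PolyTime : {A B : Set} → (A → Val) → (B → Val) → (A → B) → Set
PolyTime α β f =
  ∃[ m ] Σ[ P ∈ Cmd (suc m) ] ∃[ a ] ∃[ d ]
    ∀ x → ∃[ t ] Run P (α x) (β (f x)) t × t ≤ a * ‖ α x ‖ ^ d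

encodeList : {A : Set} → (A → Val) → List A → Val
encodeList α = foldr (λ x v → pair (α x) v) (nat 0)

encodeFin : ∀ {n} → Fin n → Val
encodeFin i = nat (toℕ i)

-- Numbers are written in binary, but V is listed explicitly, so the size of an
-- instance is at least its number of vertices.
encode : Instance → Val
encode I =
  pair (encodeList encodeFin (allFin n))
  (pair (encodeList
          (λ ((u , v) , c) → pair (pair (encodeFin u) (encodeFin v)) (encodeFin c))
          edges)
  (pair (nat p) (nat k)))
  where open Instance I

{-# OPTIONS --safe #-}
module Submission where

open import Data.Bool.Base using (Bool; true; false; not)
import Data.Bool.Properties as Bool
open import Data.Fin.Base as Fin using (Fin; zero; suc; toℕ)
import Data.Fin.Properties as Fin
open import Data.Fin.Subset using (Subset; _∈_; _∉_; _⊆_; _⊂_; ⊤; ⁅_⁆; ⋃; ∣_∣)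
open import Data.Fin.Subset.Properties
open import Data.List.Base using (List; []; _∷_; _++_; map; filter; foldr; foldl; length; reverse; cartesianProduct; allFin)
open import Data.List.Membership.Propositional using (find; lose) renaming (_∈_ to _∈ₗ_)
open import Data.List.Membership.Propositional.Properties
open import Data.List.Properties using (reverse-foldr; length-++; length-map; length-tabulate; filter-notAll)
import Data.List.Relation.Binary.Permutation.Propositional as Perm
import Data.List.Relation.Binary.Permutation.Propositional.Properties as Perm
import Data.List.Relation.Binary.Permutation.Setoid.Properties as SetoidPerm
open import Data.List.Relation.Binary.Sublist.Propositional using ([]; _∷_; _∷ʳ_) renaming (_⊆_ to _⊑_)
import Data.List.Relation.Binary.Sublist.Propositional.Properties as Sublist
open import Data.List.Relation.Binary.Subset.Propositional using () renaming (_⊆_ to _⊆ₗ_)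
open import Data.List.Relation.Unary.All as All using (All; []; _∷_)
open import Data.List.Relation.Unary.All.Properties using (¬All⇒Any¬)
open import Data.List.Relation.Unary.AllPairs using (AllPairs; []; _∷_)
open import Data.List.Relation.Unary.Any as Any using (Any; here; there)
open import Data.List.Relation.Unary.Unique.Propositional using (Unique)
import Data.List.Relation.Unary.Unique.Propositional.Properties as Unique
open import Data.Nat.Base
open import Data.Nat.Combinatorics using (_C_; nC1≡n; nCk+nC[k+1]≡[n+1]C[k+1])
open import Data.Nat.Induction using (<-rec)
open import Data.Nat.Logarithm
open import Data.Nat.Properties
open import Data.Nat.Tactic.RingSolver using (solve-∀)
open import Data.Product.Base using (_×_; _,_; proj₁; proj₂; ∃-syntax; Σ-syntax; swap)
open import Data.Sum.Base using (_⊎_; inj₁; inj₂)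
open import Data.Vec.Base using ([]; _∷_; lookup; updateAt; _[_]≔_)
open import Data.Vec.Properties using (lookup∘updateAt; lookup∘updateAt′; []=⇒lookup; lookup⇒[]=)
import Data.Vec.Relation.Unary.All as Vec
open import Data.Vec.Relation.Unary.All using ([]; _∷_)
open import Data.Vec.Relation.Unary.All.Properties using (lookup⁺)
open import Function.Base using (_∘_; case_of_; flip)
open import Relation.Binary.Definitions using (tri<; tri≈; tri>)
open import Relation.Binary.PropositionalEquality
open import Relation.Nullary.Decidable using (Dec; yes; no; _×-dec_; _⊎-dec_; ¬?; decidable-stable)
open import Relation.Nullary.Negation using (¬_; contradiction)
open import Defs

-- The kernel keeps at most (p−1)² + 1 edges of each colour and nothing else changes.
-- A cut S that misses colour i and meets q ≤ p−1 colours has q witness edges, one per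
-- colour, and these have at most q ends on each side of S.  So at most q² edges of
-- colour i join two witness ends; if there are more edges of colour i, one of them has
-- an endpoint that no witness touches, and moving it to the other side gains colour i
-- without losing a colour.  Hence a colour whose class was truncated can be added to
-- every cut of the kernel.
--
-- The program rebuilds the edge list and recounts, for each edge, the kept edges of its
-- colour: quadratically many loop iterations, each of cost linear in the sizes of the
-- stored values, which stay linear in the input size.

-- Trimming colour classes, and counting in lists.

ColouredEdge : ℕ → ℕ → Set
ColouredEdge n p = Edge n × Fin p

colour : ∀ {n p} → ColouredEdge n p → Fin p
colour = proj₂

class : ∀ {n p} → Fin p → List (ColouredEdge n p) → List (ColouredEdge n p)
class i = filter (λ e → colour e Fin.≟ i)

-- Only edges already kept are counted, so folding from the right keeps the last `M` edges of each
-- colour.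
addUpTo : ∀ {n p} → ℕ → ColouredEdge n p → List (ColouredEdge n p) → List (ColouredEdge n p)
addUpTo M e es with length (class (colour e) es) <? M
... | yes _ = e ∷ es
... | no _  = es

trim : ∀ {n p} → ℕ → List (ColouredEdge n p) → List (ColouredEdge n p)
trim M = foldr (addUpTo M) []

-- The least class size to which `extend` applies.
cap : ℕ → ℕ
cap p = 1 + (p ∸ 1) * (p ∸ 1)

AllPairs-resp-⊒ : ∀ {A : Set} {R : A → A → Set} {xs ys : List A} → xs ⊑ ys → AllPairs R ys → AllPairs R xs
AllPairs-resp-⊒ []         []         = []
AllPairs-resp-⊒ (_ ∷ʳ τ)   (_ ∷ rs)   = AllPairs-resp-⊒ τ rs
AllPairs-resp-⊒ (refl ∷ τ) (r ∷ rs)   = Sublist.All-resp-⊆ τ r ∷ AllPairs-resp-⊒ τ rs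

-- Pigeonhole: one occurrence of the head is deleted from `ys`, and distinctness keeps the tail
-- inside what remains.
length-mono-Unique : ∀ {A : Set} {xs ys : List A} → Unique xs → xs ⊆ₗ ys → length xs ≤ length ys
length-mono-Unique {xs = []} [] _ = z≤n
length-mono-Unique {xs = x ∷ xs} (x∉xs ∷ xs!) xs⊆ys with ∈-∃++ (xs⊆ys (here refl))
... | as , bs , refl = begin
  suc (length xs)               ≤⟨ s≤s (length-mono-Unique xs! xs⊆as++bs) ⟩
  suc (length (as ++ bs))       ≡⟨ cong suc (length-++ as) ⟩
  suc (length as + length bs)   ≡⟨ +-suc (length as) (length bs) ⟨
  length as + suc (length bs)   ≡⟨ length-++ as ⟨
  length (as ++ x ∷ bs)         ∎
  where
  open ≤-Reasoning
  xs⊆as++bs : xs ⊆ₗ as ++ bs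
  xs⊆as++bs y∈xs with ∈-++⁻ as (xs⊆ys (there y∈xs))
  ... | inj₁ y∈as         = ∈-++⁺ˡ y∈as
  ... | inj₂ (here refl)  = contradiction refl (All.lookup x∉xs y∈xs)
  ... | inj₂ (there y∈bs) = ∈-++⁺ʳ as y∈bs

length-cartesianProduct : ∀ {A B : Set} (xs : List A) (ys : List B) →
  length (cartesianProduct xs ys) ≡ length xs * length ys
length-cartesianProduct [] ys = refl
length-cartesianProduct (x ∷ xs) ys =
  trans (length-++ (map (x ,_) ys)) (cong₂ _+_ (length-map (x ,_) ys) (length-cartesianProduct xs ys))

module _ {n p : ℕ} where

  length-class-∷ : ∀ i (e : ColouredEdge n p) es → length (class i es) ≤ length (class i (e ∷ es))
  length-class-∷ i e es with colour e Fin.≟ i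
  ... | yes _ = n≤1+n _
  ... | no  _ = ≤-refl

  trim-⊑ : ∀ M (es : List (ColouredEdge n p)) → trim M es ⊑ es
  trim-⊑ M [] = []
  trim-⊑ M (e ∷ es) with length (class (colour e) (trim M es)) <? M
  ... | yes _ = refl ∷ trim-⊑ M es
  ... | no _  = e ∷ʳ trim-⊑ M es

  trim-∈ : ∀ M {e} (es : List (ColouredEdge n p)) → e ∈ₗ trim M es → e ∈ₗ es
  trim-∈ M es = Sublist.Any-resp-⊆ (trim-⊑ M es)

  trim-class≤ : ∀ M i (es : List (ColouredEdge n p)) → length (class i (trim M es)) ≤ M
  trim-class≤ M i [] = z≤n
  trim-class≤ M i (e ∷ es) with length (class (colour e) (trim M es)) <? M
  ... | no _ = trim-class≤ M i es
  ... | yes c<M with colour e Fin.≟ i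
  ...   | yes refl = c<M
  ...   | no _     = trim-class≤ M i es

  -- An edge is rejected only when the kept part of its class is full, and that part never shrinks
  -- afterwards. So a class is either full or untouched.
  trim-saturated : ∀ M i (es : List (ColouredEdge n p)) →
    M ≤ length (class i (trim M es)) ⊎ (∀ {e} → e ∈ₗ es → colour e ≡ i → e ∈ₗ trim M es)
  trim-saturated M i [] = inj₂ λ ()
  trim-saturated M i (e ∷ es) with trim-saturated M i es | length (class (colour e) (trim M es)) <? M
  ... | inj₁ M≤c | yes _ = inj₁ (≤-trans M≤c (length-class-∷ i e (trim M es)))
  ... | inj₁ M≤c | no _  = inj₁ M≤c
  ... | inj₂ all | yes _ = inj₂ λ { (here refl) _ → here refl ; (there e∈es) eq → there (all e∈es eq) }
  ... | inj₂ all | no c≮M with colour e Fin.≟ i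
  ...   | yes refl = inj₁ (≮⇒≥ c≮M)
  ...   | no e≢i   = inj₂ λ { (here refl) eq → contradiction eq e≢i ; (there e∈es) eq → all e∈es eq }

  -- The classes are split off one colour at a time. The case `M = 1` bounds the number of
  -- witnesses, the case `M = cap p` the size of the kernel.
  length≤colours*M : ∀ {M} (L : List (Fin p)) (es : List (ColouredEdge n p)) →
    (∀ {e} → e ∈ₗ es → colour e ∈ₗ L) → (∀ i → length (class i es) ≤ M) → length es ≤ length L * M
  length≤colours*M [] [] _ _ = z≤n
  length≤colours*M [] (e ∷ es) es⊆L _ = case es⊆L (here refl) of λ ()
  length≤colours*M {M} (l ∷ L) es es⊆L class≤ = begin
    length es                             ≡⟨ split es ⟩
    length (class l es) + length others   ≤⟨ +-mono-≤ (class≤ l) (length≤colours*M L others others⊆L others≤) ⟩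
    M + length L * M                      ∎
    where
    open ≤-Reasoning
    l? = λ (e : ColouredEdge n p) → colour e Fin.≟ l
    others = filter (¬? ∘ l?) es

    split : ∀ fs → length fs ≡ length (class l fs) + length (filter (¬? ∘ l?) fs)
    split [] = refl
    split (f ∷ fs) with colour f Fin.≟ l
    ... | yes _ = cong suc (split fs)
    ... | no _  = trans (cong suc (split fs)) (sym (+-suc _ _))

    others⊆L : ∀ {e} → e ∈ₗ others → colour e ∈ₗ L
    others⊆L e∈ with ∈-filter⁻ (¬? ∘ l?) {xs = es} e∈
    ... | e∈es , e≢l with es⊆L e∈es
    ...   | here e≡l  = contradiction e≡l e≢l
    ...   | there e∈L = e∈L

    others≤ : ∀ i → length (class i others) ≤ M
    others≤ i = ≤-trans
      (Sublist.length-mono-≤ (Sublist.filter⁺ i? i? (λ { refl c → c }) (Sublist.filter-⊆ (¬? ∘ l?) es)))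
      (class≤ i)
      where i? = λ (e : ColouredEdge n p) → colour e Fin.≟ i

  ∈-⋃-colours⁺ : ∀ {e} {es : List (ColouredEdge n p)} → e ∈ₗ es → colour e ∈ ⋃ (map (λ f → ⁅ colour f ⁆) es)
  ∈-⋃-colours⁺ {e} (here refl)  = x∈p∪q⁺ (inj₁ (x∈⁅x⁆ (colour e)))
  ∈-⋃-colours⁺     (there e∈es) = x∈p∪q⁺ (inj₂ (∈-⋃-colours⁺ e∈es))

  ∈-⋃-colours⁻ : ∀ {i} (es : List (ColouredEdge n p)) → i ∈ ⋃ (map (λ f → ⁅ colour f ⁆) es) →
                 ∃[ e ] e ∈ₗ es × colour e ≡ i
  ∈-⋃-colours⁻ [] i∈ = contradiction i∈ ∉⊥
  ∈-⋃-colours⁻ (e ∷ es) i∈ with x∈p∪q⁻ ⁅ colour e ⁆ _ i∈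
  ... | inj₁ i∈e = e , here refl , sym (x∈⁅y⁆⇒x≡y _ i∈e)
  ... | inj₂ i∈es with ∈-⋃-colours⁻ es i∈es
  ...   | f , f∈es , eq = f , there f∈es , eq

-- Cuts

source target : ∀ {n p} → ColouredEdge n p → Fin n
source e = proj₁ (proj₁ e)
target e = proj₂ (proj₁ e)

-- For an edge that crosses `S` this is its unique endpoint on side `b`: if the source is not on
-- that side, the target is.
end : ∀ {n p} → Subset n → Bool → ColouredEdge n p → Fin n
end S b e with lookup S (source e) Bool.≟ b
... | yes _ = source e
... | no _  = target e

module Cuts {p} (G : EdgeColouredGraph p) where

  open EdgeColouredGraph G

  Crosses⇒≢ : ∀ {S} e → Crosses S e → lookup S (source e) ≢ lookup S (target e)
  Crosses⇒≢ {S} e (inj₁ (u∈S , v∉S)) eq = v∉S (lookup⇒[]= _ S (trans (sym eq) ([]=⇒lookup u∈S)))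
  Crosses⇒≢ {S} e (inj₂ (u∉S , v∈S)) eq = u∉S (lookup⇒[]= _ S (trans eq ([]=⇒lookup v∈S)))

  ≢⇒Crosses : ∀ {S} e → lookup S (source e) ≢ lookup S (target e) → Crosses S e
  ≢⇒Crosses {S} e neq with source e ∈? S | target e ∈? S
  ... | yes u∈S | yes v∈S = contradiction (trans ([]=⇒lookup u∈S) (sym ([]=⇒lookup v∈S))) neq
  ... | yes u∈S | no v∉S  = inj₁ (u∈S , v∉S)
  ... | no u∉S  | yes v∈S = inj₂ (u∉S , v∈S)
  ... | no u∉S  | no v∉S  = contradiction (trans (outside u∉S) (sym (outside v∉S))) neq
    where
    outside : ∀ {x} → x ∉ S → lookup S x ≡ false
    outside {x} x∉S with lookup S x in eq
    ... | true  = contradiction (lookup⇒[]= x S eq) x∉S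
    ... | false = refl

  ∈c[∂]⁺ : ∀ {S e} → e ∈ₗ edges → Crosses S e → colour e ∈ c[∂ S ]
  ∈c[∂]⁺ {S} e∈ crosses = ∈-⋃-colours⁺ (∈-filter⁺ (crosses? S) e∈ crosses)

  ∈c[∂]⁻ : ∀ {S i} → i ∈ c[∂ S ] → ∃[ e ] e ∈ₗ edges × Crosses S e × colour e ≡ i
  ∈c[∂]⁻ {S} i∈ with ∈-⋃-colours⁻ (∂ S) i∈
  ... | e , e∈∂ , eq with ∈-filter⁻ (crosses? S) e∈∂
  ...   | e∈ , crosses = e , e∈ , crosses , eq

  move : Fin n → Subset n → Subset n
  move x S = updateAt S x not

  move-preserves : ∀ {S x} e → x ≢ source e → x ≢ target e → Crosses S e → Crosses (move x S) e
  move-preserves {S} {x} e x≢u x≢v crosses = ≢⇒Crosses e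
    (subst₂ _≢_ (sym (lookup∘updateAt′ _ x (x≢u ∘ sym) S)) (sym (lookup∘updateAt′ _ x (x≢v ∘ sym) S)) (Crosses⇒≢ e crosses))

  -- An uncut edge has both ends on the same side, and `ordered` makes the ends distinct, so
  -- flipping one leaves the other in place.
  move-creates : ∀ {S x} e → e ∈ₗ edges → x ≡ source e ⊎ x ≡ target e → ¬ Crosses S e → Crosses (move x S) e
  move-creates {S} {x} e e∈ x∈e ¬crosses = ≢⇒Crosses e (neq x∈e)
    where
    u≢v : source e ≢ target e
    u≢v = Fin.<⇒≢ (All.lookup ordered e∈)
    same : lookup S (source e) ≡ lookup S (target e)
    same = decidable-stable (_ Bool.≟ _) (¬crosses ∘ ≢⇒Crosses e)
    neq : x ≡ source e ⊎ x ≡ target e → lookup (move x S) (source e) ≢ lookup (move x S) (target e)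
    neq (inj₁ refl) = subst₂ _≢_ (sym (lookup∘updateAt x S)) (sym (lookup∘updateAt′ _ x (u≢v ∘ sym) S))
      (Bool.not-¬ (sym same) ∘ sym)
    neq (inj₂ refl) = subst₂ _≢_ (sym (lookup∘updateAt′ _ x u≢v S)) (sym (lookup∘updateAt x S))
      (Bool.not-¬ same)

  -- Counting uncut edges between witness ends.

  Touches : Fin n → ColouredEdge n p → Set
  Touches x e = x ≡ source e ⊎ x ≡ target e

  touched? : ∀ x W → Dec (Any (Touches x) W)
  touched? x = Any.any? (λ e → (x Fin.≟ source e) ⊎-dec (x Fin.≟ target e))

  -- A crossing edge has only one end on the side of `x`, so an edge that touches `x` must have `x`
  -- as that end.
  touched⇒end : ∀ {S x} W → All (Crosses S) W → Any (Touches x) W → x ∈ₗ map (end S (lookup S x)) W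
  touched⇒end (e ∷ W) (_ ∷ cs) (there t) = there (touched⇒end W cs t)
  touched⇒end {S} {x} (e ∷ W) (c ∷ _) (here x∈e) = here (x≡end x∈e)
    where
    x≡end : Touches x e → x ≡ end S (lookup S x) e
    x≡end t with lookup S (source e) Bool.≟ lookup S x
    x≡end (inj₁ x≡u)  | yes _ = x≡u
    x≡end (inj₂ refl) | yes eq = contradiction eq (Crosses⇒≢ e c)
    x≡end (inj₁ refl) | no neq = contradiction refl neq
    x≡end (inj₂ x≡v)  | no _ = x≡v

  -- Both orientations of the uncut edges are listed, because then |W|² is simply the
  -- number of ordered pairs of ends of W on one side of the cut.
  uncut≤|W|² : ∀ {S i W} → All (Crosses S) W → i ∉ c[∂ S ] →
    All (λ e → Any (Touches (source e)) W × Any (Touches (target e)) W) (class i edges) →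
    classSize i ≤ length W * length W
  uncut≤|W|² {S} {i} {W} W-crosses i∉ all-touched = *-cancelˡ-≤ 2 (begin
    2 * classSize i                     ≡⟨ cong₂ (λ a b → a + (b + 0)) (sym |F|) (sym |F|) ⟩
    length F + (length F + 0)           ≡⟨ cong (length F +_) (trans (+-identityʳ _) (sym (length-map swap F))) ⟩
    length F + length (map swap F)      ≡⟨ length-++ F ⟨
    length (F ++ map swap F)            ≤⟨ length-mono-Unique unique contained ⟩
    length (pairs true ++ pairs false)  ≡⟨ length-++ (pairs true) ⟩
    length (pairs true) + length (pairs false) ≡⟨ cong₂ _+_ (|pairs| true) (|pairs| false) ⟩
    length W * length W + length W * length W ≡⟨ cong (length W * length W +_) (+-identityʳ _) ⟨
    2 * (length W * length W)           ∎)
    where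
    open ≤-Reasoning
    F : List (Edge n)
    F = map proj₁ (class i edges)
    pairs : Bool → List (Edge n)
    pairs b = cartesianProduct (map (end S b) W) (map (end S b) W)

    |F| : length F ≡ classSize i
    |F| = length-map proj₁ (class i edges)
    |pairs| : ∀ b → length (pairs b) ≡ length W * length W
    |pairs| b = trans (length-cartesianProduct A A) (cong₂ _*_ |A| |A|)
      where
      A = map (end S b) W
      |A| = length-map (end S b) W

    ends : ∀ {uv} → uv ∈ₗ F → let (u , v) = uv in
      u Fin.< v × lookup S u ≡ lookup S v × Any (Touches u) W × Any (Touches v) W
    ends uv∈ with ∈-map⁻ proj₁ uv∈
    ... | e , e∈ , refl with ∈-filter⁻ (λ f → colour f Fin.≟ i) {xs = edges} e∈
    ...   | e∈edges , refl =
      All.lookup ordered e∈edges ,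
      decidable-stable (_ Bool.≟ _) (i∉ ∘ ∈c[∂]⁺ e∈edges ∘ ≢⇒Crosses e) ,
      All.lookup all-touched e∈

    F! : Unique F
    F! = AllPairs-resp-⊒ (Sublist.map⁺ proj₁ (Sublist.filter-⊆ _ edges)) simple

    unique : Unique (F ++ map swap F)
    unique = Unique.++⁺ F! (Unique.map⁺ (cong swap) F!) disjoint
      where
      -- Pairs in `F` are increasing and swapped pairs decreasing.
      disjoint : ∀ {uv} → ¬ (uv ∈ₗ F × uv ∈ₗ map swap F)
      disjoint (uv∈ , uv∈swap) with ∈-map⁻ swap uv∈swap
      ... | _ , vu∈ , refl = <-asym (proj₁ (ends uv∈)) (proj₁ (ends vu∈))

    split : ∀ {uv} b → uv ∈ₗ pairs b → uv ∈ₗ pairs true ++ pairs false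
    split true  = ∈-++⁺ˡ
    split false = ∈-++⁺ʳ (pairs true)

    contained : F ++ map swap F ⊆ₗ pairs true ++ pairs false
    contained uv∈ with ∈-++⁻ F uv∈
    ... | inj₁ uv∈F with ends uv∈F
    -- Both ends lie on one side of `S`, and that side selects `pairs true` or `pairs false`.
    ...   | _ , same , tu , tv = split _ (∈-cartesianProduct⁺ (touched⇒end W W-crosses tu)
            (subst (λ b → _ ∈ₗ map (end S b) W) (sym same) (touched⇒end W W-crosses tv)))
    contained uv∈ | inj₂ uv∈swap with ∈-map⁻ swap uv∈swap
    ... | _ , vu∈F , refl with ends vu∈F
    ...   | _ , same , tv , tu = split _ (∈-cartesianProduct⁺ (touched⇒end W W-crosses tu)
            (subst (λ b → _ ∈ₗ map (end S b) W) same (touched⇒end W W-crosses tv)))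

  -- Adding colours with large classes to a cut.

  extend : ∀ S i → (p ∸ 1) * (p ∸ 1) < classSize i → ∃[ S′ ] i ∈ c[∂ S′ ] × c[∂ S ] ⊆ c[∂ S′ ]
  extend S i large with i ∈? c[∂ S ]
  ... | yes i∈ = S , i∈ , λ j∈ → j∈
  ... | no i∉ = result
    where
    W : List (ColouredEdge n p)
    -- Trimming the cut to one edge per colour selects the witnesses.
    W = trim 1 (∂ S)

    W-crossing : ∀ {e} → e ∈ₗ W → e ∈ₗ edges × Crosses S e
    W-crossing = ∈-filter⁻ (crosses? S) {xs = edges} ∘ trim-∈ 1 (∂ S)

    ≢i? = λ j → ¬? (j Fin.≟ i)

    |W|≤p-1 : length W ≤ p ∸ 1
    |W|≤p-1 = begin
      length W                ≤⟨ length≤colours*M others W colours⊆ (λ j → trim-class≤ 1 j (∂ S)) ⟩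
      length others * 1       ≡⟨ *-identityʳ _ ⟩
      -- The colour `i` is filtered out, so `others` is strictly shorter than `allFin p`; this gives
      -- `p ∸ 1` instead of `p`.
      length others           ≤⟨ ∸-monoˡ-≤ 1 (filter-notAll ≢i? (allFin p) i-missing) ⟩
      length (allFin p) ∸ 1   ≡⟨ cong (_∸ 1) (length-tabulate {n = p} (λ j → j)) ⟩
      p ∸ 1                   ∎
      where
      open ≤-Reasoning
      others : List (Fin p)
      others = filter ≢i? (allFin p)
      i-missing : Any (λ j → ¬ j ≢ i) (allFin p)
      i-missing = Any.map (λ { refl f → f refl }) (∈-allFin i)
      colours⊆ : ∀ {e} → e ∈ₗ W → colour e ∈ₗ others
      colours⊆ e∈ = ∈-filter⁺ ≢i? (∈-allFin _) λ { refl → i∉ (∈-⋃-colours⁺ (trim-∈ 1 (∂ S) e∈)) }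

    saturate : ∀ {x e} → e ∈ₗ class i edges → x ≡ source e ⊎ x ≡ target e → ¬ Any (Touches x) W →
      ∃[ S′ ] i ∈ c[∂ S′ ] × c[∂ S ] ⊆ c[∂ S′ ]
    saturate {x} {e} e∈class x∈e untouched with ∈-filter⁻ (λ f → colour f Fin.≟ i) {xs = edges} e∈class
    ... | e∈ , refl = move x S , ∈c[∂]⁺ e∈ (move-creates e e∈ x∈e (i∉ ∘ ∈c[∂]⁺ e∈)) , kept-cut
      where
      still-cut : ∀ {f} → f ∈ₗ W → colour f ∈ c[∂ move x S ]
      still-cut {f} f∈W =
        let f∈ , crosses = W-crossing f∈W
        in ∈c[∂]⁺ f∈ (move-preserves f (untouched ∘ lose f∈W ∘ inj₁) (untouched ∘ lose f∈W ∘ inj₂) crosses)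

      kept-cut : c[∂ S ] ⊆ c[∂ move x S ]
      -- Colour `j` has a witness in either case: its class in `W` has reached size 1, or no edge of
      -- colour `j` was dropped from the cut.
      kept-cut {j} j∈ with trim-saturated 1 j (∂ S)
      ... | inj₁ 1≤ with class j W in eq
      ...   | f ∷ _ with ∈-filter⁻ (λ g → colour g Fin.≟ j) {xs = W} (subst (f ∈ₗ_) (sym eq) (here refl))
      ...     | f∈W , refl = still-cut f∈W
      kept-cut {j} j∈ | inj₂ all with ∈-⋃-colours⁻ (∂ S) j∈
      ... | f , f∈∂ , refl = still-cut (all f∈∂ refl)

    both? = λ e → touched? (source e) W ×-dec touched? (target e) W

    result : ∃[ S′ ] i ∈ c[∂ S′ ] × c[∂ S ] ⊆ c[∂ S′ ]
    result with All.all? both? (class i edges)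
    -- If witnesses touch both ends of every edge of colour `i`, the class is too small for `large`;
    -- otherwise a free end can be moved.
    ... | yes all-touched = contradiction
      (≤-trans (uncut≤|W|² (All.tabulate (proj₂ ∘ W-crossing)) i∉ all-touched) (*-mono-≤ |W|≤p-1 |W|≤p-1))
      (<⇒≱ large)
    ... | no ¬all with find (¬All⇒Any¬ both? (class i edges) ¬all)
    ...   | e , e∈ , ¬both with touched? (source e) W
    ...     | no ¬u = saturate e∈ (inj₁ refl) ¬u
    ...     | yes u = saturate e∈ (inj₂ refl) (λ v → ¬both (u , v))

  -- Class sizes do not depend on the cut and `extend` loses no colour, so the colours can be added
  -- one after another.
  extendAll : ∀ L S → All (λ i → (p ∸ 1) * (p ∸ 1) < classSize i) L →
    ∃[ S′ ] All (_∈ c[∂ S′ ]) L × c[∂ S ] ⊆ c[∂ S′ ]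
  extendAll [] S [] = S , [] , λ j∈ → j∈
  extendAll (i ∷ L) S (large ∷ larges) =
    let S₁ , L⊆ , S⊆S₁  = extendAll L S larges
        S₂ , i∈ , S₁⊆S₂ = extend S₁ i large
    in S₂ , i∈ ∷ All.map S₁⊆S₂ L⊆ , S₁⊆S₂ ∘ S⊆S₁

-- The kernel

-- `Equivalent` is a disjunction, so choosing a disjunct requires a decision, made here by search
-- over all subsets. The map `kernel` itself does not call it.
yes? : ∀ I → Dec (Instance.Yes I)
yes? I = anySubset? λ S → (S ⊂? ⊤) ×-dec (k ≤? ∣ c[∂ S ] ∣)
  where open Instance I

-- The program prepends each kept edge, so its output is the trimmed reversed list.
trimGraph : ∀ {p} → EdgeColouredGraph p → EdgeColouredGraph p
trimGraph {p} G = record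
  { n       = n
  ; edges   = trim (cap p) (reverse edges)
  ; ordered = All.tabulate (All.lookup ordered ∘ Perm.∈-resp-↭ (Perm.↭-reverse edges) ∘
                            trim-∈ (cap p) (reverse edges))
  ; simple  = AllPairs-resp-⊒ (Sublist.map⁺ proj₁ (trim-⊑ (cap p) (reverse edges)))
                (SetoidPerm.Unique-resp-↭ (setoid _) (Perm.↭⇒↭ₛ (Perm.map⁺ proj₁ edges↭)) simple)
  }
  where
  open EdgeColouredGraph G
  edges↭ : edges Perm.↭ reverse edges
  edges↭ = Perm.↭-sym (Perm.↭-reverse edges)

kernel : Instance → Instance
kernel I = record { p = p ; graph = trimGraph graph ; k = k ; k>0 = k>0 }
  where open Instance I

module _ (I : Instance) where

  open Instance I
  private module K = Instance (kernel I)

  kernel-∈ : ∀ {e} → e ∈ₗ K.edges → e ∈ₗ edges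
  kernel-∈ = Perm.∈-resp-↭ (Perm.↭-reverse edges) ∘ trim-∈ (cap p) (reverse edges)

  Yes-kernel⇒Yes : K.Yes → Yes
  Yes-kernel⇒Yes (S , S⊂⊤ , k≤) = S , S⊂⊤ , ≤-trans k≤ (p⊆q⇒∣p∣≤∣q∣ λ i∈ →
    let e , e∈ , crosses , eq = Cuts.∈c[∂]⁻ K.graph i∈
    in subst (_∈ c[∂ S ]) eq (Cuts.∈c[∂]⁺ graph (kernel-∈ e∈) crosses))

  -- Full classes are added to the cut by `extendAll`; every other class is still complete, so its
  -- crossing edges survive.
  Yes⇒Yes-kernel : Yes → K.Yes
  Yes⇒Yes-kernel (S , _ , k≤) =
    let S′ , saturated⊆ , S⊆S′ = Cuts.extendAll K.graph (filter large? (allFin p)) S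
                                   (All.tabulate (proj₂ ∘ ∈-filter⁻ large? {xs = allFin p}))
        large⊆ = λ i large → All.lookup saturated⊆ (∈-filter⁺ large? (∈-allFin i) large)
        k≤′ = ≤-trans k≤ (p⊆q⇒∣p∣≤∣q∣ (cut⊆ S′ large⊆ S⊆S′))
    in S′ , proper S′ k≤′ , k≤′
    where
    large? = λ i → (p ∸ 1) * (p ∸ 1) <? K.classSize i

    cut⊆ : ∀ S′ → (∀ i → (p ∸ 1) * (p ∸ 1) < K.classSize i → i ∈ K.c[∂ S′ ]) →
           K.c[∂ S ] ⊆ K.c[∂ S′ ] → c[∂ S ] ⊆ K.c[∂ S′ ]
    cut⊆ S′ large⊆ S⊆S′ {i} i∈ with trim-saturated (cap p) i (reverse edges)
    -- `cap p` is a successor, so reaching the cap is by definition the strict inequality that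
    -- `large⊆` expects.
    ... | inj₁ large = large⊆ i large
    ... | inj₂ all with Cuts.∈c[∂]⁻ graph i∈
    ...   | e , e∈ , crosses , refl =
      S⊆S′ (Cuts.∈c[∂]⁺ K.graph (all (Perm.∈-resp-↭ (Perm.↭-sym (Perm.↭-reverse edges)) e∈) refl) crosses)

    -- Moving vertices might have made `S′` all of `V`; but `k>0` yields a crossing edge, whose
    -- outer end lies outside `S′`.
    proper : ∀ S′ → k ≤ ∣ K.c[∂ S′ ] ∣ → S′ ⊂ ⊤
    proper S′ k≤′ with nonempty? K.c[∂ S′ ]
    ... | no empty = contradiction (≤-trans k>0 k≤′) (subst (λ n → ¬ 1 ≤ n)
            (sym (trans (cong ∣_∣ (Empty-unique empty)) (∣⊥∣≡0 p))) λ ())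
    ... | yes (i , i∈) with Cuts.∈c[∂]⁻ K.graph i∈
    ...   | e , _ , inj₁ (_ , v∉) , _ = (λ _ → ∈⊤) , target e , ∈⊤ , v∉
    ...   | e , _ , inj₂ (u∉ , _) , _ = (λ _ → ∈⊤) , source e , ∈⊤ , u∉

  kernel-equivalent : Equivalent I (kernel I)
  kernel-equivalent with yes? I
  ... | yes y = inj₁ (y , Yes⇒Yes-kernel y)
  ... | no ¬y = inj₂ (¬y , ¬y ∘ Yes-kernel⇒Yes)

  kernel-#edges : K.#edges ≤ 1 * p ^ 3
  kernel-#edges = begin
    K.#edges                   ≤⟨ length≤colours*M (allFin p) K.edges (λ _ → ∈-allFin _)
                                    (λ i → trim-class≤ (cap p) i (reverse edges)) ⟩
    length (allFin p) * cap p  ≡⟨ cong (_* cap p) (length-tabulate {n = p} (λ j → j)) ⟩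
    p * cap p                  ≤⟨ p*cap≤p³ p ⟩
    1 * p ^ 3                  ∎
    where
    open ≤-Reasoning
    p*cap≤p³ : ∀ p → p * cap p ≤ 1 * p ^ 3
    p*cap≤p³ zero    = z≤n
    p*cap≤p³ (suc q) = begin
      suc q * suc (q * q)
        ≤⟨ *-monoʳ-≤ (suc q) (s≤s (≤-trans (*-monoʳ-≤ q (n≤1+n q)) (m≤n+m _ q))) ⟩
      suc q * (suc q * suc q)                ≡⟨ cube (suc q) ⟩
      1 * suc q ^ 3                          ∎
      where
      cube : ∀ m → m * (m * m) ≡ 1 * (m * (m * (m * 1)))
      cube = solve-∀

-- Induction by Pascal's rule, with the upper index shifted to avoid subtraction.
2*[1+nC2]≡[1+n]*n : ∀ n → 2 * (suc n C 2) ≡ suc n * n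
2*[1+nC2]≡[1+n]*n zero = refl
2*[1+nC2]≡[1+n]*n (suc n) = begin
  2 * (suc (suc n) C 2)               ≡⟨ cong (2 *_) (nCk+nC[k+1]≡[n+1]C[k+1] (suc n) 1) ⟨
  2 * (suc n C 1 + suc n C 2)         ≡⟨ *-distribˡ-+ 2 (suc n C 1) (suc n C 2) ⟩
  2 * (suc n C 1) + 2 * (suc n C 2)   ≡⟨ cong₂ _+_ (cong (2 *_) (nC1≡n (suc n))) (2*[1+nC2]≡[1+n]*n n) ⟩
  2 * suc n + suc n * n               ≡⟨ regroup n ⟩
  suc (suc n) * suc n                 ∎
  where
  open ≡-Reasoning
  regroup : ∀ n → 2 * suc n + suc n * n ≡ suc (suc n) * suc n
  regroup = solve-∀

-- For `p` at least 2, `1 + (p ∸ 1)²` is at most `(p ∸ 1) + (p ∸ 1)² = p(p ∸ 1)`. For smaller `p`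
-- the binomial vanishes while the cap is 1, hence the maximum with 1.
cap≤1⊔2*pC2 : ∀ p → cap p ≤ 1 ⊔ 2 * (p C 2)
cap≤1⊔2*pC2 zero          = s≤s z≤n
cap≤1⊔2*pC2 (suc zero)    = s≤s z≤n
cap≤1⊔2*pC2 (suc q@(suc _)) = begin
  1 + q * q                 ≤⟨ +-monoˡ-≤ (q * q) (s≤s z≤n) ⟩
  q + q * q                 ≡⟨ 2*[1+nC2]≡[1+n]*n q ⟨
  2 * (suc q C 2)           ≤⟨ m≤n⊔m 1 (2 * (suc q C 2)) ⟩
  1 ⊔ 2 * (suc q C 2)       ∎
  where open ≤-Reasoning

-- Sizes and costs

-- Strong induction along halving. It lets a product be bounded by a power of two in `‖⟦⟧‖≤`.
n<2^[1+⌊log₂n⌋] : ∀ n → n < 2 ^ suc ⌊log₂ n ⌋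
n<2^[1+⌊log₂n⌋] = <-rec _ go
  where
  n≤1+2⌊n/2⌋ : ∀ n → n ≤ suc (2 * ⌊ n /2⌋)
  n≤1+2⌊n/2⌋ zero = z≤n
  n≤1+2⌊n/2⌋ (suc zero) = s≤s z≤n
  n≤1+2⌊n/2⌋ (suc (suc n)) =
    subst (suc (suc n) ≤_) (cong suc (sym (*-suc 2 ⌊ n /2⌋))) (s≤s (s≤s (n≤1+2⌊n/2⌋ n)))

  1≤⌊log₂⌋ : ∀ n → 1 ≤ ⌊log₂ suc (suc n) ⌋
  1≤⌊log₂⌋ n = ⌊log₂⌋-mono-≤ {2} {suc (suc n)} (s≤s (s≤s z≤n))

  go : ∀ n → (∀ {m} → m < n → m < 2 ^ suc ⌊log₂ m ⌋) → n < 2 ^ suc ⌊log₂ n ⌋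
  go zero _ = s≤s z≤n
  go (suc zero) _ = s≤s (s≤s z≤n)
  go n@(suc (suc m)) ih = begin-strict
    n                               ≤⟨ n≤1+2⌊n/2⌋ n ⟩
    suc (2 * h)                     <⟨ n<1+n _ ⟩
    suc (suc (2 * h))               ≡⟨ *-suc 2 h ⟨
    2 * suc h                       ≤⟨ *-monoʳ-≤ 2 (ih (⌊n/2⌋<n (suc m))) ⟩
    2 * 2 ^ suc ⌊log₂ h ⌋           ≡⟨ cong (λ l → 2 * 2 ^ suc l) (⌊log₂⌊n/2⌋⌋≡⌊log₂n⌋∸1 n) ⟩
    -- Here `n` is at least 2, so its logarithm is positive and the truncated predecessor is exact.
    2 * 2 ^ suc (⌊log₂ n ⌋ ∸ 1)     ≡⟨ cong (λ l → 2 * 2 ^ l) (m+[n∸m]≡n (1≤⌊log₂⌋ m)) ⟩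
    2 ^ suc ⌊log₂ n ⌋               ∎
    where
    open ≤-Reasoning
    h = ⌊ n /2⌋

‖v‖≥1 : ∀ v → 1 ≤ ‖ v ‖
‖v‖≥1 (nat _)    = s≤s z≤n
‖v‖≥1 (pair _ _) = s≤s z≤n

‖first‖≤ : ∀ v → ‖ first v ‖ ≤ ‖ v ‖
‖first‖≤ (nat _)    = s≤s z≤n
‖first‖≤ (pair v w) = m≤n⇒m≤1+n (m≤m+n ‖ v ‖ ‖ w ‖)

‖second‖≤ : ∀ v → ‖ second v ‖ ≤ ‖ v ‖
‖second‖≤ (nat _)    = s≤s z≤n
‖second‖≤ (pair v w) = m≤n⇒m≤1+n (m≤n+m ‖ w ‖ ‖ v ‖)

‖asℕ‖≤ : ∀ v → ‖ nat (asℕ v) ‖ ≤ ‖ v ‖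
‖asℕ‖≤ (nat _)    = ≤-refl
‖asℕ‖≤ (pair _ _) = s≤s z≤n

‖nat‖-mono : ∀ {m n} → m ≤ n → ‖ nat m ‖ ≤ ‖ nat n ‖
‖nat‖-mono m≤n = s≤s (⌊log₂⌋-mono-≤ m≤n)

-- A product bounds all three operations at once, and its logarithm becomes a sum. The successors
-- keep the bound valid when an argument is 0.
⟦⟧≤[1+m]*[1+n] : ∀ o m n → ⟦ o ⟧ m n ≤ suc m * suc n
⟦⟧≤[1+m]*[1+n] add   m n = begin
  m + n           ≤⟨ m≤n⇒m≤1+n (+-monoˡ-≤ n (m≤m*n m (suc n))) ⟩
  suc (m * suc n + n) ≡⟨ cong suc (+-comm (m * suc n) n) ⟩
  suc m * suc n   ∎
  where open ≤-Reasoning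
⟦⟧≤[1+m]*[1+n] monus m n = ≤-trans (m∸n≤m m n) (≤-trans (n≤1+n m) (m≤m*n (suc m) (suc n)))
⟦⟧≤[1+m]*[1+n] mul   m n = *-mono-≤ (n≤1+n m) (n≤1+n n)

‖⟦⟧‖≤ : ∀ o m n → ‖ nat (⟦ o ⟧ m n) ‖ ≤ suc (‖ nat m ‖ + ‖ nat n ‖)
‖⟦⟧‖≤ o m n = s≤s (begin
  ⌊log₂ ⟦ o ⟧ m n ⌋                       ≤⟨ ⌊log₂⌋-mono-≤ (⟦⟧≤[1+m]*[1+n] o m n) ⟩
  ⌊log₂ suc m * suc n ⌋                   ≤⟨ ⌊log₂⌋-mono-≤ (*-mono-≤ (n<2^[1+⌊log₂n⌋] m) (n<2^[1+⌊log₂n⌋] n)) ⟩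
  ⌊log₂ 2 ^ ‖ nat m ‖ * 2 ^ ‖ nat n ‖ ⌋   ≡⟨ cong ⌊log₂_⌋ (^-distribˡ-+-* 2 ‖ nat m ‖ ‖ nat n ‖) ⟨
  ⌊log₂ 2 ^ (‖ nat m ‖ + ‖ nat n ‖) ⌋     ≡⟨ ⌊log₂[2^n]⌋≡n (‖ nat m ‖ + ‖ nat n ‖) ⟩
  ‖ nat m ‖ + ‖ nat n ‖                   ∎)
  where open ≤-Reasoning

-- A factor by which evaluation can enlarge the bound `B` on stored values. The `suc` pays for the
-- new node of a pair or the extra bit of an arithmetic result.
weight : ∀ {m} → Expr m → ℕ
weight (var _)       = 1
weight (lit n)       = ‖ nat n ‖
weight (cons e f)    = suc (weight e + weight f)
weight (hd e)        = weight e
weight (tl e)        = weight e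
weight (arith _ e f) = suc (weight e + weight f)

costWeight : ∀ {m} → Expr m → ℕ
subcostWeight : ∀ {m} → Expr m → ℕ
costWeight e = weight e + subcostWeight e
subcostWeight (var _)       = 0
subcostWeight (lit _)       = 0
subcostWeight (cons e f)    = costWeight e + costWeight f
subcostWeight (hd e)        = costWeight e
subcostWeight (tl e)        = costWeight e
subcostWeight (arith _ e f) = costWeight e + costWeight f

Bounded : ∀ {m} → ℕ → Store m → Set
Bounded B = Vec.All (λ v → ‖ v ‖ ≤ B)

module _ {m B} {σ : Store m} (1≤B : 1 ≤ B) (σ≤B : Bounded B σ) where

  open ≤-Reasoning

  private
    +-weights : ∀ {x y} a b → x ≤ a * B → y ≤ b * B → x + y ≤ (a + b) * B
    +-weights {x} {y} a b x≤ y≤ = begin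
      x + y           ≤⟨ +-mono-≤ x≤ y≤ ⟩
      a * B + b * B   ≡⟨ *-distribʳ-+ B a b ⟨
      (a + b) * B     ∎

    suc-weights : ∀ {x y} a b → x ≤ a * B → y ≤ b * B → suc (x + y) ≤ suc (a + b) * B
    suc-weights a b x≤ y≤ = +-mono-≤ 1≤B (+-weights a b x≤ y≤)

  ‖eval‖≤ : ∀ e → ‖ eval σ e ‖ ≤ weight e * B
  ‖eval‖≤ (var x)       = ≤-trans (lookup⁺ σ≤B x) (m≤m+n B 0)
  ‖eval‖≤ (lit n)       = m≤m*n ‖ nat n ‖ B {{>-nonZero 1≤B}}
  ‖eval‖≤ (cons e f)    = suc-weights (weight e) (weight f) (‖eval‖≤ e) (‖eval‖≤ f)
  ‖eval‖≤ (hd e)        = ≤-trans (‖first‖≤ (eval σ e)) (‖eval‖≤ e)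
  ‖eval‖≤ (tl e)        = ≤-trans (‖second‖≤ (eval σ e)) (‖eval‖≤ e)
  ‖eval‖≤ (arith o e f) = ≤-trans (‖⟦⟧‖≤ o (asℕ (eval σ e)) (asℕ (eval σ f)))
    (suc-weights (weight e) (weight f)
      (≤-trans (‖asℕ‖≤ (eval σ e)) (‖eval‖≤ e))
      (≤-trans (‖asℕ‖≤ (eval σ f)) (‖eval‖≤ f)))

  cost≤ : ∀ e → cost σ e ≤ costWeight e * B
  subcost≤ : ∀ e → subcost σ e ≤ subcostWeight e * B
  cost≤ e = +-weights (weight e) (subcostWeight e) (‖eval‖≤ e) (subcost≤ e)
  subcost≤ (var x)       = z≤n
  subcost≤ (lit n)       = z≤n
  subcost≤ (cons e f)    = +-weights (costWeight e) (costWeight f) (cost≤ e) (cost≤ f)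
  subcost≤ (hd e)        = cost≤ e
  subcost≤ (tl e)        = cost≤ e
  subcost≤ (arith _ e f) = +-weights (costWeight e) (costWeight f) (cost≤ e) (cost≤ f)

-- The program

-- `remaining` is the unread part of the edge list and `scan` a cursor through `kept`; `budget`
-- starts at the cap and drops by one for each kept edge of the current colour, stopping at 0.
pattern input     = zero
pattern remaining = suc zero
pattern kept      = suc (suc zero)
pattern scan      = suc (suc (suc zero))
pattern budget    = suc (suc (suc (suc zero)))

colour₁ colour₂ spend capExpr keepExpr outputExpr : Expr 5
colour₁ = tl (hd (var remaining))
colour₂ = tl (hd (var scan))
-- With truncated subtraction, 1 ∸ ((a ∸ b) + (b ∸ a)) is 1 if a ≡ b and 0 otherwise.
spend = arith monus (var budget)
  (arith monus (lit 1) (arith add (arith monus colour₁ colour₂) (arith monus colour₂ colour₁)))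
capExpr = arith add (lit 1) (arith mul p-1 p-1)
  where p-1 = arith monus (hd (tl (tl (var input)))) (lit 1)
keepExpr = cons (hd (var remaining)) (var kept)
outputExpr = cons (hd (var input)) (cons (var kept) (tl (tl (var input))))

scanBody scanLoop keepBody mainBody mainLoop program : Cmd 5
scanBody = budget := spend ⨾ scan := tl (var scan)
scanLoop = while (var scan) scanBody
keepBody = if (var budget) (kept := keepExpr) skip
mainBody = scan := var kept ⨾ budget := capExpr ⨾ scanLoop ⨾ keepBody ⨾
           remaining := tl (var remaining)
mainLoop = while (var remaining) mainBody
program  = remaining := hd (tl (var input)) ⨾ mainLoop ⨾
           input := outputExpr

-- `linearWeight` is charged once per main iteration, `scanWeight` once per inner iteration and
-- hence up to `B` times. The `1` in `keepWeight` covers `skip`.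
scanWeight keepWeight linearWeight mainWeight timeWeight : ℕ
scanWeight = costWeight {5} (var scan) + (costWeight spend + costWeight {5} (tl (var scan)))
keepWeight = costWeight {5} (var budget) + (costWeight keepExpr + 1)
linearWeight = costWeight {5} (var kept) + (costWeight capExpr
  + (keepWeight + (costWeight {5} (tl (var remaining)) + costWeight {5} (var remaining))))
mainWeight = linearWeight + scanWeight
timeWeight = costWeight {5} (hd (tl (var input))) + (mainWeight + costWeight outputExpr)

-- Correctness and running time of the program.

_⟶_⟨_⟩_ : ∀ {m} → Store m → Store m → ℕ → Cmd m → Set
_⟶_⟨_⟩_ σ τ T P = ∃[ t ] Exec P σ τ t × t ≤ T

encodeEdge : ∀ {n p} → ColouredEdge n p → Val
encodeEdge e = pair (pair (encodeFin (source e)) (encodeFin (target e))) (encodeFin (colour e))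

encodeEdges : ∀ {n p} → List (ColouredEdge n p) → Val
encodeEdges = encodeList encodeEdge

-- Bounds the iterations of both loops by input size; strictness leaves room for the final loop
-- test.
length<‖encodeEdges‖ : ∀ {n p} (es : List (ColouredEdge n p)) → length es < ‖ encodeEdges es ‖
length<‖encodeEdges‖ [] = s≤s z≤n
length<‖encodeEdges‖ (e ∷ es) =
  s≤s (≤-trans (length<‖encodeEdges‖ es) (m≤n+m ‖ encodeEdges es ‖ ‖ encodeEdge e ‖))

module _ {B} (1≤B : 1 ≤ B) where

  open ≤-Reasoning

  assign≤ : ∀ {m} {σ : Store m} x e → Bounded B σ →
            σ ⟶ σ [ x ]≔ eval σ e ⟨ costWeight e * B ⟩ (x := e)
  assign≤ x e σ≤B = _ , assign , cost≤ 1≤B σ≤B e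

  -- Equal colours have difference 0 and cost one unit of budget; distinct colours have a positive
  -- symmetric difference, and truncation makes the decrement 0.
  spent : ∀ {n p} (e f : ColouredEdge n p) (fs : List (ColouredEdge n p)) r →
          r ∸ (1 ∸ ((toℕ (colour e) ∸ toℕ (colour f)) + (toℕ (colour f) ∸ toℕ (colour e))))
            ∸ length (class (colour e) fs)
          ≡ r ∸ length (class (colour e) (f ∷ fs))
  spent e f fs r with colour f Fin.≟ colour e
  ... | yes eq rewrite eq | n∸n≡0 (toℕ (colour e)) = ∸-+-assoc r 1 _
  ... | no neq = cong (λ d → r ∸ d ∸ length (class (colour e) fs)) (m≤n⇒m∸n≡0 (distinct neq))
    where
    distinct : ∀ {n} {i j : Fin n} → j ≢ i → 1 ≤ (toℕ i ∸ toℕ j) + (toℕ j ∸ toℕ i)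
    distinct {i = i} {j} j≢i with <-cmp (toℕ i) (toℕ j)
    ... | tri< i<j _ _ = m≤n⇒m≤o+n (toℕ i ∸ toℕ j) (m<n⇒0<n∸m i<j)
    ... | tri≈ _ i≡j _ = contradiction (sym (Fin.toℕ-injective i≡j)) j≢i
    ... | tri> _ _ j<i = m≤n⇒m≤n+o (toℕ j ∸ toℕ i) (m<n⇒0<n∸m j<i)

  scanLoop-correct : ∀ {n p} (e : ColouredEdge n p) (fs : List (ColouredEdge n p)) r {v rest a} →
    Bounded B (v ∷ pair (encodeEdge e) rest ∷ a ∷ encodeEdges fs ∷ nat r ∷ []) →
    (v ∷ pair (encodeEdge e) rest ∷ a ∷ encodeEdges fs ∷ nat r ∷ [])
      ⟶ (v ∷ pair (encodeEdge e) rest ∷ a ∷ nat 0 ∷ nat (r ∸ length (class (colour e) fs)) ∷ [])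
      ⟨ suc (length fs) * (scanWeight * B) ⟩ scanLoop
  scanLoop-correct e [] r σ≤B = _ , exit refl , (begin
    1                               ≤⟨ 1≤B ⟩
    B                               ≤⟨ m≤m+n B _ ⟩
    scanWeight * B                  ≤⟨ m≤m+n _ 0 ⟩
    1 * (scanWeight * B)            ∎)
  scanLoop-correct e (f ∷ fs) r {v} {rest} {a} σ≤B@(v≤ ∷ x≤ ∷ a≤ ∷ y≤ ∷ r≤ ∷ []) =
    subst (λ s → σ ⟶ τ s ⟨ suc (suc (length fs)) * (scanWeight * B) ⟩ scanLoop) (spent e f fs r)
      (let r′≤ = ≤-trans (‖nat‖-mono (m∸n≤m r d)) r≤
           ys≤ = ≤-trans (‖second‖≤ (encodeEdges (f ∷ fs))) y≤
           _ , run₁ , t₁≤ = assign≤ budget spend σ≤B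
           _ , run₂ , t₂≤ = assign≤ scan (tl (var scan)) (v≤ ∷ x≤ ∷ a≤ ∷ y≤ ∷ r′≤ ∷ [])
           _ , run₃ , t₃≤ = scanLoop-correct e fs (r ∸ d) (v≤ ∷ x≤ ∷ a≤ ∷ ys≤ ∷ r′≤ ∷ [])
       in _ , loop (λ ()) (seq run₁ run₂) run₃ , (begin
         _ ≤⟨ +-mono-≤ (cost≤ 1≤B σ≤B (var scan)) (+-mono-≤ (+-mono-≤ t₁≤ t₂≤) t₃≤) ⟩
         1 * B + ((w₁ * B + w₂ * B) + suc (length fs) * (scanWeight * B))
           ≡⟨ sum w₁ w₂ B (suc (length fs) * (scanWeight * B)) ⟩
         suc (suc (length fs)) * (scanWeight * B) ∎))
    where
    w₁ = costWeight spend
    w₂ = costWeight {5} (tl (var scan))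
    σ : Store 5
    σ = v ∷ pair (encodeEdge e) rest ∷ a ∷ encodeEdges (f ∷ fs) ∷ nat r ∷ []
    τ : ℕ → Store 5
    τ s = v ∷ pair (encodeEdge e) rest ∷ a ∷ nat 0 ∷ nat s ∷ []
    d : ℕ
    d = 1 ∸ ((toℕ (colour e) ∸ toℕ (colour f)) + (toℕ (colour f) ∸ toℕ (colour e)))
    sum : ∀ b c B l → 1 * B + ((b * B + c * B) + l) ≡ (1 + (b + c)) * B + l
    sum = solve-∀

  -- The budget is `nat 0`, hence false, exactly when the class has at least `M` kept edges, so the
  -- test agrees with the one in `addUpTo`.
  keepBody-correct : ∀ {n p} M (e : ColouredEdge n p) (fs : List (ColouredEdge n p)) {v rest} →
    let b = nat (M ∸ length (class (colour e) fs)) in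
    Bounded B (v ∷ pair (encodeEdge e) rest ∷ encodeEdges fs ∷ nat 0 ∷ b ∷ []) →
    (v ∷ pair (encodeEdge e) rest ∷ encodeEdges fs ∷ nat 0 ∷ b ∷ [])
      ⟶ (v ∷ pair (encodeEdge e) rest ∷ encodeEdges (addUpTo M e fs) ∷ nat 0 ∷ b ∷ [])
      ⟨ keepWeight * B ⟩ keepBody
  keepBody-correct M e fs σ≤B with length (class (colour e) fs) <? M
  ... | yes c<M =
    let _ , run , t≤ = assign≤ kept keepExpr σ≤B
    in _ , ifTrue (λ eq → m<n⇒n∸m≢0 c<M (cong asℕ eq)) run , (begin
      _ ≤⟨ +-mono-≤ (cost≤ 1≤B σ≤B (var budget)) t≤ ⟩
      1 * B + costWeight keepExpr * B ≡⟨ *-distribʳ-+ B 1 (costWeight keepExpr) ⟨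
      (1 + costWeight keepExpr) * B   ≤⟨ *-monoˡ-≤ B (+-monoʳ-≤ 1 (m≤m+n (costWeight keepExpr) 1)) ⟩
      keepWeight * B ∎)
    where
    m<n⇒n∸m≢0 : ∀ {m n} → m < n → n ∸ m ≢ 0
    m<n⇒n∸m≢0 m<n eq = contradiction (m∸n≡0⇒m≤n eq) (<⇒≱ m<n)
  ... | no c≮M = _ , ifFalse (cong nat (m≤n⇒m∸n≡0 (≮⇒≥ c≮M))) skip , (begin
      _ ≤⟨ +-mono-≤ (cost≤ 1≤B σ≤B (var budget)) 1≤B ⟩
      1 * B + B                       ≡⟨ +-comm (1 * B) B ⟩
      2 * B                           ≤⟨ *-monoˡ-≤ B (+-monoʳ-≤ 1 (m≤n+m 1 (costWeight keepExpr))) ⟩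
      keepWeight * B ∎)

  B≤B² : B ≤ B * B
  B≤B² = m≤m*n B B {{>-nonZero 1≤B}}

  ‖addUpTo‖≤ : ∀ {n p} M (e : ColouredEdge n p) (fs : List (ColouredEdge n p)) →
    ‖ encodeEdges (addUpTo M e fs) ‖ ≤ suc (‖ encodeEdge e ‖ + ‖ encodeEdges fs ‖)
  ‖addUpTo‖≤ M e fs with length (class (colour e) fs) <? M
  ... | yes _ = ≤-refl
  ... | no  _ = m≤n⇒m≤1+n (m≤n+m _ ‖ encodeEdge e ‖)

  module _ {p k vs gs} (v≤B : ‖ pair vs (pair gs (pair (nat p) (nat k))) ‖ ≤ B)
            (cap≤B : ‖ nat (cap p) ‖ ≤ B) where

    private
      v : Val
      v = pair vs (pair gs (pair (nat p) (nat k)))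

    -- The invariant bounds the sum of the sizes of the two lists: an edge passes from one to the
    -- other or is dropped, so the sum never grows, although `kept` alone may.
    mainLoop-correct : ∀ {n} (es fs : List (ColouredEdge n p)) r →
      ‖ encodeEdges es ‖ + ‖ encodeEdges fs ‖ ≤ B → ‖ nat r ‖ ≤ B →
      ∃[ r′ ]
        let σ = v ∷ encodeEdges es ∷ encodeEdges fs ∷ nat 0 ∷ nat r ∷ []
            τ = v ∷ nat 0 ∷ encodeEdges (foldl (flip (addUpTo (cap p))) fs es) ∷ nat 0 ∷ nat r′ ∷ []
        in Bounded B τ × σ ⟶ τ ⟨ suc (length es) * (mainWeight * (B * B)) ⟩ mainLoop
    mainLoop-correct [] fs r lists≤B r≤B =
      r , (v≤B ∷ 1≤B ∷ m+n≤o⇒n≤o 1 lists≤B ∷ 1≤B ∷ r≤B ∷ []) , _ , exit refl , (begin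
      1                               ≤⟨ 1≤B ⟩
      B                               ≡⟨ *-identityˡ B ⟨
      1 * B                           ≤⟨ *-mono-≤ {1} {mainWeight} (s≤s z≤n) B≤B² ⟩
      mainWeight * (B * B)            ≤⟨ m≤m+n _ 0 ⟩
      1 * (mainWeight * (B * B))      ∎)
    mainLoop-correct (e ∷ es) fs r lists≤B r≤B =
      let es≤B = m+n≤o⇒m≤o ‖ encodeEdges (e ∷ es) ‖ lists≤B
          fs≤B = m+n≤o⇒n≤o ‖ encodeEdges (e ∷ es) ‖ lists≤B
          σ₀≤B = v≤B ∷ es≤B ∷ fs≤B ∷ 1≤B ∷ r≤B ∷ []
          σ₁≤B = v≤B ∷ es≤B ∷ fs≤B ∷ fs≤B ∷ r≤B ∷ []
          σ₂≤B = v≤B ∷ es≤B ∷ fs≤B ∷ fs≤B ∷ cap≤B ∷ []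
          b≤B  = ≤-trans (‖nat‖-mono (m∸n≤m (cap p) (length (class (colour e) fs)))) cap≤B
          σ₃≤B = v≤B ∷ es≤B ∷ fs≤B ∷ 1≤B ∷ b≤B ∷ []
          lists′≤B = ≤-trans (moved e es fs) lists≤B
          kept≤B = m+n≤o⇒n≤o ‖ encodeEdges es ‖ lists′≤B
          σ₄≤B = v≤B ∷ es≤B ∷ kept≤B ∷ 1≤B ∷ b≤B ∷ []
          _ , run₁ , t₁≤ = assign≤ scan (var kept) σ₀≤B
          _ , run₂ , t₂≤ = assign≤ budget capExpr σ₁≤B
          _ , run₃ , t₃≤ = scanLoop-correct e fs (cap p) σ₂≤B
          _ , run₄ , t₄≤ = keepBody-correct (cap p) e fs σ₃≤B
          _ , run₅ , t₅≤ = assign≤ remaining (tl (var remaining)) σ₄≤B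
          r′ , τ≤B , _ , run , t≤ = mainLoop-correct es (addUpTo (cap p) e fs) _ lists′≤B b≤B
          -- At most `B` inner tests of cost linear in `B` give the quadratic term.
          t₃≤′ = ≤-trans t₃≤ (*-monoˡ-≤ (scanWeight * B) (≤-trans (length<‖encodeEdges‖ fs) fs≤B))
      in r′ , τ≤B , _ , loop (λ ()) (seq run₁ (seq run₂ (seq run₃ (seq run₄ run₅)))) run , (begin
        _ ≤⟨ +-mono-≤ (cost≤ 1≤B σ₀≤B (var remaining))
               (+-mono-≤ (+-mono-≤ t₁≤ (+-mono-≤ t₂≤ (+-mono-≤ t₃≤′ (+-mono-≤ t₄≤ t₅≤)))) t≤) ⟩
        _ ≡⟨ sum (costWeight {5} (var kept)) (costWeight capExpr) keepWeight
                 (costWeight {5} (tl (var remaining))) (costWeight {5} (var remaining)) scanWeight B _ ⟩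
        linearWeight * B + scanWeight * (B * B) + suc (length es) * (mainWeight * (B * B))
          ≤⟨ +-monoˡ-≤ _ (+-monoˡ-≤ _ (*-monoʳ-≤ linearWeight B≤B²)) ⟩
        linearWeight * (B * B) + scanWeight * (B * B) + suc (length es) * (mainWeight * (B * B))
          ≡⟨ cong (_+ suc (length es) * (mainWeight * (B * B))) (*-distribʳ-+ (B * B) linearWeight scanWeight) ⟨
        suc (suc (length es)) * (mainWeight * (B * B)) ∎)
      where
      moved : ∀ {n} (e : ColouredEdge n p) (es fs : List (ColouredEdge n p)) →
        ‖ encodeEdges es ‖ + ‖ encodeEdges (addUpTo (cap p) e fs) ‖
          ≤ ‖ encodeEdges (e ∷ es) ‖ + ‖ encodeEdges fs ‖
      moved e es fs = begin
        ‖ encodeEdges es ‖ + _ ≤⟨ +-monoʳ-≤ ‖ encodeEdges es ‖ (‖addUpTo‖≤ (cap p) e fs) ⟩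
        ‖ encodeEdges es ‖ + suc (‖ encodeEdge e ‖ + ‖ encodeEdges fs ‖)
          ≡⟨ shuffle (‖ encodeEdges es ‖) (‖ encodeEdge e ‖) (‖ encodeEdges fs ‖) ⟩
        _ ∎
        where
        shuffle : ∀ a b c → a + suc (b + c) ≡ suc (b + a) + c
        shuffle = solve-∀
      sum : ∀ w₁ w₂ w₄ w₅ w₀ w₃ B l →
        w₀ * B + ((w₁ * B + (w₂ * B + (B * (w₃ * B) + (w₄ * B + w₅ * B)))) + l)
          ≡ (w₁ + (w₂ + (w₄ + (w₅ + w₀)))) * B + w₃ * (B * B) + l
      sum = solve-∀

timeFactor : ℕ
timeFactor = timeWeight * weight capExpr ^ 3

-- At most `B` main loop tests, each with quadratic cost, give a cubic bound. The loop computes a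
-- left fold, which `reverse-foldr` identifies with `trim` of the reversed list.
program-correct : ∀ I → ∃[ t ] Run program (encode I) (encode (kernel I)) t ×
                               t ≤ timeFactor * ‖ encode I ‖ ^ 3
program-correct I =
  let r , τ≤B , _ , run₂ , t₂≤ = mainLoop-correct 1≤B v≤B cap≤B edges [] 0 lists≤B 1≤B
      _ , run₁ , t₁≤ = assign≤ 1≤B remaining (hd (tl (var input))) σ≤B
      _ , run₃ , t₃≤ = assign≤ 1≤B input outputExpr τ≤B
  in _ , (_ , seq run₁ (seq run₂ run₃) , cong output (sym (reverse-foldr (addUpTo (cap p)) [] edges))) , (begin
    _ ≤⟨ +-mono-≤ t₁≤ (+-mono-≤ (≤-trans t₂≤ (*-monoˡ-≤ (mainWeight * (B * B)) len≤B)) t₃≤) ⟩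
    w₁ * B + (B * (mainWeight * (B * B)) + w₃ * B)
      ≤⟨ +-mono-≤ (*-monoʳ-≤ w₁ B≤B³) (+-monoʳ-≤ (B * (mainWeight * (B * B))) (*-monoʳ-≤ w₃ B≤B³)) ⟩
    w₁ * (B * (B * B)) + (B * (mainWeight * (B * B)) + w₃ * (B * (B * B)))
      ≡⟨ collect w₁ mainWeight w₃ (weight capExpr) ‖ encode I ‖ ⟩
    timeFactor * ‖ encode I ‖ ^ 3 ∎)
  where
  open Instance I
  open ≤-Reasoning
  w₁ = costWeight {5} (hd (tl (var input)))
  w₃ = costWeight outputExpr

  output : List (ColouredEdge n p) → Val
  output es = pair (encodeList encodeFin (allFin n)) (pair (encodeEdges es) (pair (nat p) (nat k)))

  -- The factor leaves room for the cap, which is computed from `p` and may be larger than any input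
  -- value.
  B = weight capExpr * ‖ encode I ‖
  σ₀ : Store 5
  σ₀ = encode I ∷ nat 0 ∷ nat 0 ∷ nat 0 ∷ nat 0 ∷ []

  v≤B : ‖ encode I ‖ ≤ B
  v≤B = m≤n*m ‖ encode I ‖ (weight capExpr)

  1≤B : 1 ≤ B
  1≤B = ≤-trans (‖v‖≥1 (encode I)) v≤B

  σ≤B : Bounded B σ₀
  σ≤B = v≤B ∷ 1≤B ∷ 1≤B ∷ 1≤B ∷ 1≤B ∷ []

  cap≤B : ‖ nat (cap p) ‖ ≤ B
  cap≤B = ‖eval‖≤ {σ = σ₀} (‖v‖≥1 (encode I))
    (≤-refl ∷ 1≤N ∷ 1≤N ∷ 1≤N ∷ 1≤N ∷ []) capExpr
    where 1≤N = ‖v‖≥1 (encode I)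

  lists≤N : ‖ encodeEdges edges ‖ + 1 ≤ ‖ encode I ‖
  lists≤N = begin
    e + 1                         ≡⟨ +-comm e 1 ⟩
    suc e                         ≤⟨ s≤s (m≤m+n e _) ⟩
    suc (e + ‖ pair (nat p) (nat k) ‖)  ≤⟨ m≤n+m _ _ ⟩
    ‖ encodeList encodeFin (allFin n) ‖ + suc (e + ‖ pair (nat p) (nat k) ‖) ≤⟨ n≤1+n _ ⟩
    ‖ encode I ‖                  ∎
    where e = ‖ encodeEdges edges ‖

  lists≤B : ‖ encodeEdges edges ‖ + 1 ≤ B
  lists≤B = ≤-trans lists≤N v≤B

  len≤B : suc (length edges) ≤ B
  len≤B = ≤-trans (length<‖encodeEdges‖ edges) (m+n≤o⇒m≤o ‖ encodeEdges edges ‖ lists≤B)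

  B≤B³ : B ≤ B * (B * B)
  B≤B³ = m≤m*n B (B * B) {{>-nonZero (≤-trans 1≤B (B≤B² 1≤B))}}

  collect : ∀ a b c w N →
            a * (w * N * (w * N * (w * N)))
              + (w * N * (b * (w * N * (w * N))) + c * (w * N * (w * N * (w * N))))
            ≡ (a + (b + c)) * (w * (w * (w * 1))) * (N * (N * (N * 1)))
  collect = solve-∀

theorem4 : Σ[ f ∈ (Instance → Instance) ]
    (PolyTime encode encode f
    × (Σ[ b ∈ ℕ ] ((I : Instance) →
    Equivalent I (f I)
    × Instance.p (f I) ≤ Instance.p I
    × Instance.k (f I) ≤ Instance.k I
    × Instance.#edges (f I) ≤ b * Instance.p I ^ 3
    × ((i : Fin (Instance.p (f I))) → Instance.classSize (f I) i ≤ 1 ⊔ 2 * (Instance.p I C 2)))))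
theorem4 =
  kernel ,
  (4 , program , timeFactor , 3 , program-correct) ,
  1 , λ I → kernel-equivalent I , ≤-refl , ≤-refl , kernel-#edges I ,
    λ i → ≤-trans (trim-class≤ (cap (Instance.p I)) i (reverse (Instance.edges I)))
                  (cap≤1⊔2*pC2 (Instance.p I))
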